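{- Let $G$ be a finite simple graph of even order, let $f:V(G)\rightarrow \mathbb{Z}^+$ be an even integer-valued function with $f(v)\geq 4$ for all $v\in V(G)$, and let $H_f(v)=\{1,3,\ldots,f(v)-1,f(v)\}$ for $v\in V(G)$. If $$o(G-S)\leq f(S)\qquad\text{for all } S\subseteq V(G),$$ then $G$ contains an $H_f$-factor.
   Context: For $S\subseteq V(G)$, $f(S)=\sum_{x\in S}f(x)$ (so $f(\emptyset)=0$), and $o(G-S)$ denotes the number of components of odd order of $G-S$. For a set function $H$ assigning to each vertex $v$ a set $H(v)$ of integers, an $H$-factor of $G$ is a spanning subgraph $F$ of $G$ with $d_F(v)\in H(v)$ for every $v\in V(G)$. -}

module Defs where

open import Data.Nat using (ℕ; zero; suc; _+_; _<_; _≤_)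
open import Data.Nat.Divisibility using (_∣_)
open import Data.Bool using (Bool; true; false; _∧_; _∨_; not; if_then_else_)
open import Data.Fin using (Fin; toℕ; _≟_)
open import Data.Fin.Properties using ()
open import Data.Product using (_×_)
open import Data.Sum using (_⊎_)
open import Data.List using (List; foldr; map)
open import Data.Bool.ListAction using (any; all)
open import Data.List using () renaming (allFin to allFinL)
open import Data.Nat using (_<ᵇ_)
open import Relation.Nullary using (¬_)
open import Relation.Nullary.Decidable using (⌊_⌋)
open import Relation.Binary.PropositionalEquality using (_≡_)

record Graph (n : ℕ) : Set where
  field
    adj    : Fin n → Fin n → Bool
    sym    : ∀ x y → adj x y ≡ adj y x
    irrefl : ∀ x → adj x x ≡ false
open Graph public

VSet : ℕ → Set
VSet n = Fin n → Bool

count : {n : ℕ} → VSet n → ℕ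
count {n} p = foldr (λ i acc → (if p i then 1 else 0) + acc) 0 (allFinL n)

fSum : {n : ℕ} → (Fin n → ℕ) → VSet n → ℕ
fSum {n} f S = foldr (λ i acc → (if S i then f i else 0) + acc) 0 (allFinL n)

reachUpTo : {n : ℕ} → Graph n → VSet n → ℕ → Fin n → Fin n → Bool
reachUpTo G S zero x y = not (S x) ∧ ⌊ x ≟ y ⌋
reachUpTo {n} G S (suc k) x y =
  reachUpTo G S k x y ∨
  any (λ z → reachUpTo G S k x z ∧ adj G z y ∧ not (S y)) (allFinL n)

-- x and y lie in the same component of G - S (both outside S);
-- walks of length ≤ n suffice in an n-vertex graph.
reach : {n : ℕ} → Graph n → VSet n → Fin n → Fin n → Bool
reach {n} G S = reachUpTo G S n

isOddℕ : ℕ → Bool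
isOddℕ zero = false
isOddℕ (suc zero) = true
isOddℕ (suc (suc m)) = isOddℕ m

isRep : {n : ℕ} → Graph n → VSet n → Fin n → Bool
isRep {n} G S v = not (S v) ∧ all (λ w → not (reach G S v w ∧ (toℕ w <ᵇ toℕ v))) (allFinL n)

oddComponents : {n : ℕ} → Graph n → VSet n → ℕ
oddComponents G S = count (λ v → isRep G S v ∧ isOddℕ (count (reach G S v)))

record Spanning {n : ℕ} (G : Graph n) : Set where
  field
    edge   : Fin n → Fin n → Bool
    esym   : ∀ x y → edge x y ≡ edge y x
    sub    : ∀ x y → edge x y ≡ true → adj G x y ≡ true
open Spanning public

degree : {n : ℕ} {G : Graph n} → Spanning G → Fin n → ℕ
degree F v = count (edge F v)

Hf : ℕ → ℕ → Set
Hf fv d = ((¬ (2 ∣ d)) × d < fv) ⊎ d ≡ fv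

IsHFactor : {n : ℕ} {G : Graph n} → (Fin n → ℕ → Set) → Spanning G → Set
IsHFactor H F = ∀ v → H v (degree F v)

{-# OPTIONS --safe #-}
module Submission where

-- Call v bad in a subgraph F with d_F ≤ f if d_F(v) is even and d_F(v) < f(v); an H_f-factor is
-- such an F without bad vertices. Let F₀ have the fewest bad vertices, u₀ be one of them, and E be
-- the set of vertices of full degree f(v). Since a bad vertex may be raised or lowered by one,
-- toggling an edge ur with r ∉ E, or with ur ∈ F and r ∈ E, moves the badness of u to r, or lowers
-- the number of bad vertices. So badness moves freely inside a component of G - E, which then has
-- no F-edge to E, and it crosses t ∈ E by adding ut and deleting an F-edge tr.
-- Let Q be the set of vertices reachable from u₀ in this way and S the neighbours of Q in E. Every
-- component of G[Q] is an odd component of G - S, by counting degrees when the bad vertex is in it.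
-- All f(S) edges of F₀ at S lead to Q, at most one into each component and none into that of u₀,
-- so f(S) < o(G - S).

open import Defs
open import Data.Nat using (ℕ; _≤_)
open import Data.Nat.Divisibility using (_∣_)
open import Data.Fin using (Fin)
open import Data.Product using (Σ)
open import Data.Nat using (zero; suc; _+_; _*_; _<_; z≤n; s≤s)
open import Data.Nat.Properties
  using (+-0-commutativeMonoid; +-mono-≤; +-mono-<-≤; +-mono-≤-<; +-suc; +-identityʳ; ≤-refl;
         ≤-reflexive; ≤-trans; ≤-<-trans; <-≤-trans; <-irrefl; n≤1+n; n<1+n;
         ≤∧≢⇒<; m≤m+n; m≤n+m; <ᵇ⇒<; suc-injective; module ≤-Reasoning)
import Data.Nat.Properties as ℕ
open import Data.Nat.Divisibility using (divides; _∣?_)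
open import Data.Bool using (Bool; true; false; _∧_; _∨_; _xor_; not; if_then_else_)
open import Data.Bool.ListAction using (any; all)
open import Data.Bool.Properties using (T-≡; not-involutive; not-injective; ¬-not; ∨-zeroʳ; xor-assoc)
import Data.Bool.Properties as Bool
open import Data.Fin using (zero; suc; toℕ; _≟_)
open import Data.Fin.Properties using (any?; all?)
open import Data.List using (foldr; tabulate)
open import Data.Product using (∃; _×_; _,_; proj₁; proj₂)
open import Data.Sum using (_⊎_; inj₁; inj₂)
open import Data.Empty using (⊥; ⊥-elim)
open import Data.Vec.Functional using (_∷_)
open import Function using (_∘_; id; Equivalence)
open import Relation.Nullary using (¬_; Dec; yes; no; ¬?)
open import Relation.Nullary.Decidable using (⌊_⌋; _×-dec_; _⊎-dec_; _→-dec_; map′; decidable-stable)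
open import Relation.Binary.PropositionalEquality
  using (_≡_; _≢_; refl; cong; cong₂; subst; trans; module ≡-Reasoning) renaming (sym to ≡-sym)
open import Algebra.Properties.CommutativeMonoid.Sum +-0-commutativeMonoid
  using (sum; sum-cong-≗; ∑-distrib-+; ∑-comm)

-- Finite sums and counting

ind : Bool → ℕ
ind b = if b then 1 else 0

-- The statement counts by folding over a list. Passing to `sum` gives access to `∑-comm` and
-- `∑-distrib-+`, on which the double counting rests.
foldr-tabulate : ∀ {A : Set} {n} (g : A → ℕ) (h : Fin n → A) →
  foldr (λ a acc → g a + acc) 0 (tabulate h) ≡ sum (g ∘ h)
foldr-tabulate {n = zero}  g h = refl
foldr-tabulate {n = suc n} g h = cong (g (h zero) +_) (foldr-tabulate g (h ∘ suc))

count≡sum : ∀ {n} (p : VSet n) → count p ≡ sum (ind ∘ p)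
count≡sum p = foldr-tabulate (λ i → ind (p i)) id

fSum≡sum : ∀ {n} (f : Fin n → ℕ) (S : VSet n) → fSum f S ≡ sum (λ i → if S i then f i else 0)
fSum≡sum f S = foldr-tabulate (λ i → if S i then f i else 0) id

count-cong : ∀ {n} {p q : VSet n} → (∀ i → p i ≡ q i) → count p ≡ count q
count-cong {p = p} {q} eq =
  trans (count≡sum p) (trans (sum-cong-≗ (cong ind ∘ eq)) (≡-sym (count≡sum q)))

sum-zero : ∀ {n} (g : Fin n → ℕ) → (∀ i → g i ≡ 0) → sum g ≡ 0
sum-zero {zero}  g g≡0 = refl
sum-zero {suc n} g g≡0 = cong₂ _+_ (g≡0 zero) (sum-zero (g ∘ suc) (g≡0 ∘ suc))

sum-mono-≤ : ∀ {n} {g h : Fin n → ℕ} → (∀ i → g i ≤ h i) → sum g ≤ sum h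
sum-mono-≤ {zero}  g≤h = z≤n
sum-mono-≤ {suc n} g≤h = +-mono-≤ (g≤h zero) (sum-mono-≤ (g≤h ∘ suc))

sum-mono-< : ∀ {n} {g h : Fin n → ℕ} → (∀ i → g i ≤ h i) → ∀ k → g k < h k → sum g < sum h
sum-mono-< g≤h zero    lt = +-mono-<-≤ lt (sum-mono-≤ (g≤h ∘ suc))
sum-mono-< g≤h (suc k) lt = +-mono-≤-< (g≤h zero) (sum-mono-< (g≤h ∘ suc) k lt)

sum-single : ∀ {n} (g : Fin n → ℕ) k → (∀ i → i ≢ k → g i ≡ 0) → sum g ≡ g k
sum-single g zero    g≡0 =
  trans (cong (g zero +_) (sum-zero (g ∘ suc) λ i → g≡0 (suc i) λ ())) (+-identityʳ _)
sum-single g (suc k) g≡0 =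
  cong₂ _+_ (g≡0 zero λ ())
    (sum-single (g ∘ suc) k λ i i≢k → g≡0 (suc i) λ { refl → i≢k refl })

term≤sum : ∀ {n} (g : Fin n → ℕ) k → g k ≤ sum g
term≤sum g zero    = m≤m+n _ _
term≤sum g (suc k) = ≤-trans (term≤sum (g ∘ suc) k) (m≤n+m _ _)

sum-update : ∀ {n} (g h : Fin n → ℕ) k → (∀ i → i ≢ k → g i ≡ h i) → g k ≡ suc (h k) →
  sum g ≡ suc (sum h)
sum-update g h zero    off at =
  cong₂ _+_ at (sum-cong-≗ λ i → off (suc i) λ ())
sum-update g h (suc k) off at =
  trans (cong₂ _+_ (off zero λ ())
          (sum-update (g ∘ suc) (h ∘ suc) k (λ i i≢k → off (suc i) λ { refl → i≢k refl }) at))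
        (+-suc _ _)

ind-mono : ∀ {a b} → (a ≡ true → b ≡ true) → ind a ≤ ind b
ind-mono {false}        _  = z≤n
ind-mono {true} {true}  _  = ≤-refl
ind-mono {true} {false} ab with () ← ab refl

count-mono-< : ∀ {n} {p q : VSet n} → (∀ i → p i ≡ true → q i ≡ true) →
  ∀ k → p k ≡ false → q k ≡ true → count p < count q
count-mono-< {p = p} {q} p⊆q k pk qk rewrite count≡sum p | count≡sum q =
  sum-mono-< (ind-mono ∘ p⊆q) k
    (≤-reflexive (trans (cong (suc ∘ ind) pk) (cong ind (≡-sym qk))))

count≤n : ∀ {n} (p : VSet n) → count p ≤ n
count≤n p rewrite count≡sum p = bound (ind ∘ p) λ i → ind-mono {p i} {true} λ _ → refl
  where
  bound : ∀ {n} (g : Fin n → ℕ) → (∀ i → g i ≤ 1) → sum g ≤ n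
  bound {zero}  g g≤1 = z≤n
  bound {suc n} g g≤1 = +-mono-≤ (g≤1 zero) (bound (g ∘ suc) (g≤1 ∘ suc))

count-update : ∀ {n} {p q : VSet n} k → (∀ i → i ≢ k → p i ≡ q i) →
  p k ≡ true → q k ≡ false → count p ≡ suc (count q)
count-update {p = p} {q} k off pk qk rewrite count≡sum p | count≡sum q =
  sum-update (ind ∘ p) (ind ∘ q) k (λ i i≢k → cong ind (off i i≢k))
    (trans (cong ind pk) (cong (suc ∘ ind) (≡-sym qk)))

-- Parity

isOdd-suc : ∀ m → isOddℕ (suc m) ≡ not (isOddℕ m)
isOdd-suc zero          = refl
isOdd-suc (suc zero)    = refl
isOdd-suc (suc (suc m)) = isOdd-suc m

isOdd-+ : ∀ a b → isOddℕ (a + b) ≡ isOddℕ a xor isOddℕ b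
isOdd-+ zero          b = refl
isOdd-+ (suc zero)    b = isOdd-suc b
isOdd-+ (suc (suc a)) b = isOdd-+ a b

2∣⇒even : ∀ m → 2 ∣ m → isOddℕ m ≡ false
2∣⇒even _ (divides k refl) = even k
  where
  even : ∀ k → isOddℕ (k * 2) ≡ false
  even zero    = refl
  even (suc k) = even k

isOdd-sum-evens : ∀ {n} (g : Fin n → ℕ) → (∀ i → isOddℕ (g i) ≡ false) → isOddℕ (sum g) ≡ false
isOdd-sum-evens {zero}  g even = refl
isOdd-sum-evens {suc n} g even =
  trans (isOdd-+ (g zero) _) (cong₂ _xor_ (even zero) (isOdd-sum-evens (g ∘ suc) (even ∘ suc)))

isOdd-sum-single : ∀ {n} (g : Fin n → ℕ) k → (∀ i → i ≢ k → isOddℕ (g i) ≡ false) →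
  isOddℕ (sum g) ≡ isOddℕ (g k)
isOdd-sum-single g zero    even = trans (isOdd-+ (g zero) _)
  (trans (cong (isOddℕ (g zero) xor_) (isOdd-sum-evens (g ∘ suc) λ i → even (suc i) λ ()))
         (Bool.xor-identityʳ _))
isOdd-sum-single g (suc k) even = trans (isOdd-+ (g zero) _)
  (cong₂ _xor_ (even zero λ ())
    (isOdd-sum-single (g ∘ suc) k λ i i≢k → even (suc i) λ { refl → i≢k refl }))

-- By symmetry the first row and the first column, off the diagonal, have equal sums and cancel
-- modulo 2; what remains is a smaller matrix of the same kind.
handshake : ∀ {n} (M : Fin n → Fin n → ℕ) → (∀ i j → M i j ≡ M j i) → (∀ i → M i i ≡ 0) →
  isOddℕ (sum λ i → sum (M i)) ≡ false
handshake {zero}  M M-sym M-diag = refl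
handshake {suc n} M M-sym M-diag = begin
  isOddℕ (M zero zero + row + sum (λ i → M (suc i) zero + sum (M (suc i) ∘ suc)))
    ≡⟨ cong isOddℕ (cong₂ _+_ (cong (_+ row) (M-diag zero))
         (trans (∑-distrib-+ (λ i → M (suc i) zero) _) (cong (_+ rest) (sum-cong-≗ λ i → M-sym (suc i) zero)))) ⟩
  isOddℕ (row + (row + rest))
    ≡⟨ trans (isOdd-+ row _) (cong (isOddℕ row xor_) (isOdd-+ row rest)) ⟩
  isOddℕ row xor (isOddℕ row xor isOddℕ rest)
    ≡⟨ ≡-sym (xor-assoc (isOddℕ row) (isOddℕ row) (isOddℕ rest)) ⟩
  (isOddℕ row xor isOddℕ row) xor isOddℕ rest
    ≡⟨ cong₂ _xor_ (Bool.xor-same (isOddℕ row))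
         (handshake (λ i j → M (suc i) (suc j)) (λ i j → M-sym _ _) (M-diag ∘ suc)) ⟩
  false ∎
  where
  open ≡-Reasoning
  row rest : ℕ
  row  = sum λ j → M zero (suc j)
  rest = sum λ i → sum λ j → M (suc i) (suc j)

-- Booleans

∧-true : ∀ {a b} → a ∧ b ≡ true → a ≡ true × b ≡ true
∧-true {true} {true} _ = refl , refl

∧-intro : ∀ {a b} → a ≡ true → b ≡ true → a ∧ b ≡ true
∧-intro refl refl = refl

∨-true : ∀ {a b} → a ∨ b ≡ true → a ≡ true ⊎ b ≡ true
∨-true {true}  _ = inj₁ refl
∨-true {false} p = inj₂ p

∨-introˡ : ∀ {a b} → a ≡ true → a ∨ b ≡ true
∨-introˡ refl = refl

∨-introʳ : ∀ a {b} → b ≡ true → a ∨ b ≡ true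
∨-introʳ a refl = ∨-zeroʳ a

true≢false : ∀ {b} {A : Set} → b ≡ true → b ≡ false → A
true≢false refl ()

≡true-ext : ∀ {a b} → (a ≡ true → b ≡ true) → (b ≡ true → a ≡ true) → a ≡ b
≡true-ext {true}          ab ba = ≡-sym (ab refl)
≡true-ext {false} {true}  ab ba = ba refl
≡true-ext {false} {false} ab ba = refl

isYes⁻ : ∀ {A : Set} (a? : Dec A) → ⌊ a? ⌋ ≡ true → A
isYes⁻ (yes a) _ = a

isYes⁺ : ∀ {A : Set} (a? : Dec A) → A → ⌊ a? ⌋ ≡ true
isYes⁺ (yes _) _ = refl
isYes⁺ (no ¬a) a = ⊥-elim (¬a a)

isNo⁺ : ∀ {A : Set} (a? : Dec A) → ¬ A → ⌊ a? ⌋ ≡ false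
isNo⁺ (yes a) ¬a = ⊥-elim (¬a a)
isNo⁺ (no _)  _  = refl

any-true⁻ : ∀ {A : Set} {n} (p : A → Bool) (h : Fin n → A) →
  any p (tabulate h) ≡ true → ∃ λ i → p (h i) ≡ true
any-true⁻ {n = suc n} p h eq with ∨-true {p (h zero)} eq
... | inj₁ p₀ = zero , p₀
... | inj₂ ps with any-true⁻ p (h ∘ suc) ps
...   | i , pᵢ = suc i , pᵢ

any-true⁺ : ∀ {A : Set} {n} (p : A → Bool) (h : Fin n → A) i → p (h i) ≡ true → any p (tabulate h) ≡ true
any-true⁺ p h zero    eq = ∨-introˡ eq
any-true⁺ p h (suc i) eq = ∨-introʳ (p (h zero)) (any-true⁺ p (h ∘ suc) i eq)

all-false⁻ : ∀ {A : Set} {n} (p : A → Bool) (h : Fin n → A) →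
  all p (tabulate h) ≡ false → ∃ λ i → p (h i) ≡ false
all-false⁻ {n = suc n} p h eq with p (h zero) in p₀
... | false = zero , p₀
... | true with all-false⁻ p (h ∘ suc) eq
...   | i , pᵢ = suc i , pᵢ

-- Components of G - S

-- Counterpart of `reach` without a length bound, so that walks can be concatenated and reversed.
data Conn {n} (G : Graph n) (S : VSet n) : Fin n → Fin n → Set where
  here : ∀ {x} → S x ≡ false → Conn G S x x
  step : ∀ {x z y} → Conn G S x z → adj G z y ≡ true → S y ≡ false → Conn G S x y

module _ {n} {G : Graph n} where

  conn-target : ∀ {S x y} → Conn G S x y → S y ≡ false
  conn-target (here Sx)     = Sx
  conn-target (step _ _ Sy) = Sy

  conn-source : ∀ {S x y} → Conn G S x y → S x ≡ false
  conn-source (here Sx)    = Sx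
  conn-source (step c _ _) = conn-source c

  conn-trans : ∀ {S x y z} → Conn G S x y → Conn G S y z → Conn G S x z
  conn-trans c (here _)      = c
  conn-trans c (step d a Sz) = step (conn-trans c d) a Sz

  conn-sym : ∀ {S x y} → Conn G S x y → Conn G S y x
  conn-sym (here Sx) = here Sx
  conn-sym {S} (step {z = z} {y} c a Sy) =
    conn-trans (step (here Sy) (trans (sym G y z) a) (conn-target c)) (conn-sym c)

  conn-antitone : ∀ {S S′ x y} → (∀ v → S v ≡ false → S′ v ≡ false) → Conn G S x y → Conn G S′ x y
  conn-antitone S′⊆S (here Sx)     = here (S′⊆S _ Sx)
  conn-antitone S′⊆S (step c a Sy) = step (conn-antitone S′⊆S c) a (S′⊆S _ Sy)

module _ {n} (G : Graph n) (S : VSet n) where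

  reachUpTo⇒conn : ∀ k {x y} → reachUpTo G S k x y ≡ true → Conn G S x y
  reachUpTo⇒conn zero {x} {y} r with ∧-true {not (S x)} r
  ... | nSx , x≡y with isYes⁻ (x ≟ y) x≡y
  ...   | refl = here (not-injective nSx)
  reachUpTo⇒conn (suc k) {x} {y} r with ∨-true {reachUpTo G S k x y} r
  ... | inj₁ r′ = reachUpTo⇒conn k r′
  ... | inj₂ r′ with any-true⁻ _ id r′
  ...   | z , r″ with ∧-true {reachUpTo G S k x z} r″
  ...     | xz , r‴ with ∧-true {adj G z y} r‴
  ...       | zy , nSy = step (reachUpTo⇒conn k xz) zy (not-injective nSy)

  reachUpTo-suc : ∀ k {x y} → reachUpTo G S k x y ≡ true → reachUpTo G S (suc k) x y ≡ true
  reachUpTo-suc k r = ∨-introˡ r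

  -- As long as the k-step balls around x keep growing they have more than k elements, so the
  -- n-step ball is already closed under adjacency.
  closed-or-large : ∀ k {x} → S x ≡ false →
    (∀ y → Conn G S x y → reachUpTo G S k x y ≡ true) ⊎ k < count (reachUpTo G S k x)
  closed-or-large zero {x} Sx = inj₂ (≤-trans (s≤s z≤n) (count-mono-< {p = λ _ → false} (λ _ ()) x refl base))
    where
    base : reachUpTo G S 0 x x ≡ true
    base = ∧-intro (cong not Sx) (isYes⁺ (x ≟ x) refl)
  closed-or-large (suc k) {x} Sx with closed-or-large k Sx
  ... | inj₁ closed = inj₁ λ y c → reachUpTo-suc k (closed y c)
  ... | inj₂ large
    with any? (λ y → (reachUpTo G S (suc k) x y Bool.≟ true) ×-dec (reachUpTo G S k x y Bool.≟ false))
  ...   | yes (y , new , old) =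
    inj₂ (≤-<-trans large (count-mono-< (λ _ → reachUpTo-suc k) y old new))
  ...   | no stable = inj₁ λ y c → reachUpTo-suc k (closed c)
    where
    back : ∀ {y} → reachUpTo G S (suc k) x y ≡ true → reachUpTo G S k x y ≡ true
    back {y} r with reachUpTo G S k x y Bool.≟ true
    ... | yes r′ = r′
    ... | no ¬r′ = ⊥-elim (stable (y , r , ¬-not ¬r′))
    closed : ∀ {y} → Conn G S x y → reachUpTo G S k x y ≡ true
    closed (here _) = start k
      where
      start : ∀ k → reachUpTo G S k x x ≡ true
      start zero    = ∧-intro (cong not Sx) (isYes⁺ (x ≟ x) refl)
      start (suc k) = reachUpTo-suc k (start k)
    closed {y} (step {z = z} c zy Sy) =
      back (∨-introʳ (reachUpTo G S k x y)
             (any-true⁺ _ id z (∧-intro (closed c) (∧-intro zy (cong not Sy)))))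

  reach⇒conn : ∀ {x y} → reach G S x y ≡ true → Conn G S x y
  reach⇒conn = reachUpTo⇒conn n

  conn⇒reach : ∀ {x y} → Conn G S x y → reach G S x y ≡ true
  conn⇒reach {x} {y} c with closed-or-large n (conn-source c)
  ... | inj₁ closed = closed y c
  ... | inj₂ large  = ⊥-elim (<-irrefl refl (<-≤-trans large (count≤n _)))

  -- Descent on the index from `w`: a vertex outside `S` that fails `isRep` reaches one of smaller
  -- index.
  representative : ∀ {w} → S w ≡ false → ∃ λ v → isRep G S v ≡ true × reach G S v w ≡ true
  representative {w} Sw = go _ (here Sw) (n<1+n (toℕ w))
    where
    go : ∀ k {v} → Conn G S w v → toℕ v < k → ∃ λ v → isRep G S v ≡ true × reach G S v w ≡ true
    go (suc k) {v} c (s≤s v≤k) with isRep G S v in rep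
    ... | true  = v , rep , conn⇒reach (conn-sym c)
    ... | false rewrite conn-target c with all-false⁻ _ id rep
    ...   | u , bad with ∧-true {reach G S v u} (trans (≡-sym (not-involutive _)) (cong not bad))
    ...     | vu , u<v = go k (conn-trans c (reach⇒conn vu))
                           (<-≤-trans (<ᵇ⇒< _ _ (Equivalence.from T-≡ u<v)) v≤k)

-- Decidability of existence over finite function spaces

-- `P` has to respect `_~_` because the search rebuilds a function only up to pointwise equality.
Searchable : (A : Set) → (A → A → Set) → Set₁
Searchable A _~_ = ∀ (P : A → Set) → (∀ {a b} → a ~ b → P a → P b) → (∀ a → Dec (P a)) → Dec (∃ P)

search-Bool : Searchable Bool _≡_
search-Bool P resp P? =
  map′ (λ { (inj₁ p) → true , p ; (inj₂ p) → false , p })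
       (λ { (true , p) → inj₁ p ; (false , p) → inj₂ p })
       (P? true ⊎-dec P? false)

search-→ : ∀ {A : Set} {_~_ : A → A → Set} → (∀ a → a ~ a) → Searchable A _~_ →
  ∀ n → Searchable (Fin n → A) (λ g h → ∀ i → g i ~ h i)
search-→ ~-refl search zero    P resp P? =
  map′ (λ p → _ , p) (λ (_ , p) → resp (λ ()) p) (P? λ ())
search-→ {A} {_~_} ~-refl search (suc n) P resp P? =
  map′ (λ (a , g , p) → a ∷ g , p)
       (λ (g , p) → g zero , g ∘ suc , resp (λ { zero → ~-refl _ ; (suc i) → ~-refl _ }) p)
       (search (λ a → ∃ λ g → P (a ∷ g))
          (λ a~b (g , p) → g , resp (λ { zero → a~b ; (suc i) → ~-refl _ }) p)
          (λ a → search-→ ~-refl search n (λ g → P (a ∷ g))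
             (λ g~h → resp λ { zero → ~-refl _ ; (suc i) → g~h i }) (λ g → P? (a ∷ g))))

Hf? : ∀ m d → Dec (Hf m d)
Hf? m d = (¬? (2 ∣? d) ×-dec (d ℕ.<? m)) ⊎-dec (d ℕ.≟ m)

-- This makes the proof by contradiction constructive. The search runs over all Boolean matrices,
-- with symmetry and containment in `G` moved into the predicate.
HFactor? : ∀ {n} (G : Graph n) (f : Fin n → ℕ) → Dec (Σ (Spanning G) (IsHFactor (λ v → Hf (f v))))
HFactor? {n} G f =
  map′ (λ (e , e-sym , e-sub , e-deg) → record { edge = e ; esym = e-sym ; sub = e-sub } , e-deg)
       (λ (F , F-deg) → edge F , esym F , sub F , F-deg)
       (search-→ (λ _ _ → refl) (search-→ (λ _ → refl) search-Bool n) n P resp P?)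
  where
  P : (Fin n → Fin n → Bool) → Set
  P e = (∀ x y → e x y ≡ e y x) × (∀ x y → e x y ≡ true → adj G x y ≡ true) ×
        (∀ v → Hf (f v) (count (e v)))
  resp : ∀ {d e} → (∀ x y → d x y ≡ e x y) → P d → P e
  resp d≗e (d-sym , d-sub , d-deg) =
    (λ x y → trans (≡-sym (d≗e x y)) (trans (d-sym x y) (d≗e y x))) ,
    (λ x y exy → d-sub x y (trans (d≗e x y) exy)) ,
    (λ v → subst (Hf (f v)) (count-cong (d≗e v)) (d-deg v))
  P? : ∀ e → Dec (P e)
  P? e = (all? λ x → all? λ y → e x y Bool.≟ e y x) ×-dec
         (all? λ x → all? λ y → (e x y Bool.≟ true) →-dec (adj G x y Bool.≟ true)) ×-dec
         (all? λ v → Hf? (f v) (count (e v)))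

-- Toggling an edge

isPair : ∀ {n} → Fin n → Fin n → Fin n → Fin n → Bool
isPair a b x y = (⌊ x ≟ a ⌋ ∧ ⌊ y ≟ b ⌋) ∨ (⌊ x ≟ b ⌋ ∧ ⌊ y ≟ a ⌋)

isPair-sym : ∀ {n} (a b x y : Fin n) → isPair a b x y ≡ isPair a b y x
isPair-sym a b x y =
  trans (Bool.∨-comm (⌊ x ≟ a ⌋ ∧ ⌊ y ≟ b ⌋) _)
        (cong₂ _∨_ (Bool.∧-comm ⌊ x ≟ b ⌋ _) (Bool.∧-comm ⌊ x ≟ a ⌋ _))

isPair-true⁻ : ∀ {n} (a b x y : Fin n) → isPair a b x y ≡ true → (x ≡ a × y ≡ b) ⊎ (x ≡ b × y ≡ a)
isPair-true⁻ a b x y p with ∨-true {⌊ x ≟ a ⌋ ∧ ⌊ y ≟ b ⌋} p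
... | inj₁ q = let (xa , yb) = ∧-true {⌊ x ≟ a ⌋} q in inj₁ (isYes⁻ (x ≟ a) xa , isYes⁻ (y ≟ b) yb)
... | inj₂ q = let (xb , ya) = ∧-true {⌊ x ≟ b ⌋} q in inj₂ (isYes⁻ (x ≟ b) xb , isYes⁻ (y ≟ a) ya)

isPair-refl : ∀ {n} (a b : Fin n) → isPair a b a b ≡ true
isPair-refl a b = ∨-introˡ (∧-intro (isYes⁺ (a ≟ a) refl) (isYes⁺ (b ≟ b) refl))

count-flip : ∀ {n} {p q : VSet n} w → (∀ i → i ≢ w → q i ≡ p i) → q w ≡ not (p w) →
  (p w ≡ true × count p ≡ suc (count q)) ⊎ (p w ≡ false × count q ≡ suc (count p))
count-flip {p = p} {q} w off at with p w in pw
... | true  = inj₁ (refl , count-update w (λ i i≢w → ≡-sym (off i i≢w)) pw at)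
... | false = inj₂ (refl , count-update w off at pw)

module _ {n} {G : Graph n} where

  adj⇒≢ : ∀ {a b} → adj G a b ≡ true → a ≢ b
  adj⇒≢ ab refl = true≢false ab (irrefl G _)

  toggle : (F : Spanning G) → ∀ {a b} → adj G a b ≡ true → Spanning G
  toggle F {a} {b} ab .edge x y = edge F x y xor isPair a b x y
  toggle F {a} {b} ab .esym x y = cong₂ _xor_ (esym F x y) (isPair-sym a b x y)
  toggle F {a} {b} ab .sub x y e with isPair a b x y in pair
  ... | false = sub F x y (trans (≡-sym (Bool.xor-identityʳ _)) e)
  ... | true with isPair-true⁻ a b x y pair
  ...   | inj₁ (refl , refl) = ab
  ...   | inj₂ (refl , refl) = trans (sym G _ _) ab

  module _ (F : Spanning G) {a b} (ab : adj G a b ≡ true) where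

    toggle-edge : ∀ x y → edge (toggle F ab) x y ≡ edge F x y ⊎ ((x ≡ a × y ≡ b) ⊎ (x ≡ b × y ≡ a))
    toggle-edge x y with isPair a b x y in pair
    ... | false = inj₁ (Bool.xor-identityʳ _)
    ... | true  = inj₂ (isPair-true⁻ a b x y pair)

    toggle-unchanged : ∀ x y → ¬ (x ≡ a × y ≡ b) → ¬ (x ≡ b × y ≡ a) →
      edge (toggle F ab) x y ≡ edge F x y
    toggle-unchanged x y ¬ab ¬ba with toggle-edge x y
    ... | inj₁ same      = same
    ... | inj₂ (inj₁ xy) = ⊥-elim (¬ab xy)
    ... | inj₂ (inj₂ xy) = ⊥-elim (¬ba xy)

    toggle-flips : edge (toggle F ab) a b ≡ not (edge F a b)
    toggle-flips = trans (cong (edge F a b xor_) (isPair-refl a b)) (Bool.xor-comm (edge F a b) true)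

    degree-unchanged : ∀ v → v ≢ a → v ≢ b → degree (toggle F ab) v ≡ degree F v
    degree-unchanged v v≢a v≢b =
      count-cong λ y → toggle-unchanged v y (v≢a ∘ proj₁) (v≢b ∘ proj₁)

    -- Both endpoints refer to the same Boolean `edge F a b`, so one fact about the edge decides
    -- whether the two degrees rise or fall.
    Flip : Fin n → Set
    Flip v = (edge F a b ≡ true × degree F v ≡ suc (degree (toggle F ab) v)) ⊎
             (edge F a b ≡ false × degree (toggle F ab) v ≡ suc (degree F v))

    degree-flipˡ : Flip a
    degree-flipˡ = count-flip b (λ y y≢b → toggle-unchanged a y (y≢b ∘ proj₂) (adj⇒≢ ab ∘ proj₁)) toggle-flips

    degree-flipʳ : Flip b
    degree-flipʳ = subst (λ e → (e ≡ true × degree F b ≡ suc (degree (toggle F ab) b)) ⊎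
                                (e ≡ false × degree (toggle F ab) b ≡ suc (degree F b))) (esym F b a)
      (count-flip a (λ y y≢a → toggle-unchanged b y (adj⇒≢ ab ∘ ≡-sym ∘ proj₁) (y≢a ∘ proj₂))
        (trans (esym (toggle F ab) b a) (trans toggle-flips (cong not (esym F a b)))))

    flip-parity : ∀ {v} → Flip v → isOddℕ (degree (toggle F ab) v) ≡ not (isOddℕ (degree F v))
    flip-parity {v} (inj₁ (_ , eq)) = trans (≡-sym (not-involutive _))
      (cong not (trans (≡-sym (isOdd-suc (degree (toggle F ab) v))) (cong isOddℕ (≡-sym eq))))
    flip-parity {v} (inj₂ (_ , eq)) = trans (cong isOddℕ eq) (isOdd-suc (degree F v))

    flip-≤ : ∀ {v} → Flip v → degree (toggle F ab) v ≤ suc (degree F v)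
    flip-≤ (inj₁ (_ , eq)) = ≤-trans (n≤1+n _) (≤-trans (≤-reflexive (≡-sym eq)) (n≤1+n _))
    flip-≤ (inj₂ (_ , eq)) = ≤-reflexive eq

    flip-removed : ∀ {v} → edge F a b ≡ true → Flip v → degree F v ≡ suc (degree (toggle F ab) v)
    flip-removed e (inj₁ (_ , eq)) = eq
    flip-removed e (inj₂ (¬e , _)) = true≢false e ¬e

    flip-added : ∀ {v} → edge F a b ≡ false → Flip v → degree (toggle F ab) v ≡ suc (degree F v)
    flip-added ¬e (inj₁ (e , _)) = true≢false e ¬e
    flip-added ¬e (inj₂ (_ , eq)) = eq

-- Bad vertices and their moves

Valid : ∀ {n} {G : Graph n} → (Fin n → ℕ) → Spanning G → Set
Valid f F = ∀ v → degree F v ≤ f v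

Bad : ∀ {n} {G : Graph n} → (Fin n → ℕ) → Spanning G → Fin n → Set
Bad f F v = isOddℕ (degree F v) ≡ false × degree F v ≢ f v

bad? : ∀ {n} {G : Graph n} (f : Fin n → ℕ) (F : Spanning G) v → Dec (Bad f F v)
bad? f F v = (isOddℕ (degree F v) Bool.≟ false) ×-dec ¬? (degree F v ℕ.≟ f v)

badCount : ∀ {n} {G : Graph n} → (Fin n → ℕ) → Spanning G → ℕ
badCount f F = count λ v → ⌊ bad? f F v ⌋

-- Minimality is assumed in the form of a refutation of every improvement, so no minimiser has to be
-- computed.
module Improve {n} {G : Graph n} {f : Fin n → ℕ} (f-even : ∀ v → isOddℕ (f v) ≡ false)
  (F₀ : Spanning G) (valid₀ : Valid {G = G} f F₀) {u₀ : Fin n} (bad₀ : Bad {G = G} f F₀ u₀)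
  (minimal : (F : Spanning G) → Valid {G = G} f F →
             badCount {G = G} f F < badCount {G = G} f F₀ → ⊥) where

  E : VSet n
  E v = ⌊ degree F₀ v ℕ.≟ f v ⌋

  -- Degree parity, corrected at the bad vertex `u`. Moving the badness from `u` to `r` flips the
  -- parities of just these two vertices and takes the correction along, so the charge is invariant.
  charge : Spanning G → Fin n → Fin n → Bool
  charge F u v = isOddℕ (degree F v) xor ⌊ v ≟ u ⌋

  charge-at : ∀ F {u v} → v ≡ u → charge F u v ≡ not (isOddℕ (degree F v))
  charge-at F {u} {v} v≡u =
    trans (cong (isOddℕ (degree F v) xor_) (isYes⁺ (v ≟ u) v≡u)) (Bool.xor-comm _ true)

  charge-off : ∀ F {u v} → v ≢ u → charge F u v ≡ isOddℕ (degree F v)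
  charge-off F {u} {v} v≢u =
    trans (cong (isOddℕ (degree F v) xor_) (isNo⁺ (v ≟ u) v≢u)) (Bool.xor-identityʳ _)

  -- F has the same full vertices as F₀, and its set of bad vertices is that of F₀ with u₀ moved
  -- to u.
  record State (F : Spanning G) (u : Fin n) : Set where
    field
      valid    : Valid f F
      bad      : Bad f F u
      charge-≡ : ∀ v → charge F u v ≡ charge F₀ u₀ v
      full⇒E   : ∀ v → degree F v ≡ f v → E v ≡ true
      E⇒full   : ∀ v → E v ≡ true → degree F v ≡ f v

    bad⇒¬E : E u ≡ false
    bad⇒¬E = ¬-not (proj₂ bad ∘ E⇒full u)

    -- The charge of such a `v` is `false` in `F`, hence in `F₀`. At `u₀` it is `true`, so `v`
    -- differs from `u₀` and its degree in `F₀` is even; fullness is compared through `E`.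
    others : ∀ v → v ≢ u → Bad f F v → Bad f F₀ v × v ≢ u₀
    others v v≢u (even , ¬full) with v ≟ u₀
    ... | yes v≡u₀ = true≢false
      (trans (charge-≡ v) (trans (charge-at F₀ v≡u₀)
        (cong not (trans (cong (isOddℕ ∘ degree F₀) v≡u₀) (proj₁ bad₀)))))
      (trans (charge-off F v≢u) even)
    ... | no v≢u₀ =
      (trans (≡-sym (charge-off F₀ v≢u₀)) (trans (≡-sym (charge-≡ v)) (trans (charge-off F v≢u) even)) ,
       ¬full ∘ E⇒full v ∘ isYes⁺ (degree F₀ v ℕ.≟ f v)) , v≢u₀

  open State

  initial : State F₀ u₀
  initial .valid    = valid₀
  initial .bad      = bad₀
  initial .charge-≡ v = refl
  initial .full⇒E v = isYes⁺ (degree F₀ v ℕ.≟ f v)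
  initial .E⇒full v = isYes⁻ (degree F₀ v ℕ.≟ f v)

  fewer-bad : ∀ F → Valid f F → (∀ v → Bad f F v → Bad f F₀ v × v ≢ u₀) → ⊥
  fewer-bad F valid-F bad⊆ = minimal F valid-F (count-mono-<
    (λ v b → isYes⁺ (bad? f F₀ v) (proj₁ (bad⊆ v (isYes⁻ (bad? f F v) b)))) u₀
    (isNo⁺ (bad? f F u₀) λ b → proj₂ (bad⊆ u₀ b) refl)
    (isYes⁺ (bad? f F₀ u₀) bad₀))

  -- Common core of the two moves. In `F′` the degree of `u` is odd, so `u` is no longer bad; were
  -- `r` not bad either, `F′` would contradict minimality. So `r` is bad with even degree in `F′`,
  -- its degree in `F` was odd, and it was not full because `f r` is even.
  shift : ∀ {F F′ u r} → State F u → u ≢ r →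
    (∀ v → v ≢ u → v ≢ r → degree F′ v ≡ degree F v) →
    degree F′ u ≤ f u → degree F′ r ≤ f r →
    isOddℕ (degree F′ u) ≡ not (isOddℕ (degree F u)) →
    isOddℕ (degree F′ r) ≡ not (isOddℕ (degree F r)) →
    E r ≡ false × State F′ r
  shift {F} {F′} {u} {r} s u≢r off u-valid r-valid u-flip r-flip = by-cases (bad? f F′ r)
    where
    valid′ : Valid f F′
    valid′ v with v ≟ u | v ≟ r
    ... | yes refl | _        = u-valid
    ... | no _     | yes refl = r-valid
    ... | no v≢u   | no v≢r   = subst (_≤ f v) (≡-sym (off v v≢u v≢r)) (valid s v)
    u-odd : isOddℕ (degree F′ u) ≡ true
    u-odd = trans u-flip (cong not (proj₁ (bad s)))
    by-cases : Dec (Bad f F′ r) → E r ≡ false × State F′ r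
    by-cases (no ¬bad) = ⊥-elim (fewer-bad F′ valid′ bad⊆)
      where
      bad⊆ : ∀ v → Bad f F′ v → Bad f F₀ v × v ≢ u₀
      bad⊆ v b with v ≟ u | v ≟ r
      ... | yes refl | _        = true≢false u-odd (proj₁ b)
      ... | no _     | yes refl = ⊥-elim (¬bad b)
      ... | no v≢u   | no v≢r   = others s v v≢u
        (subst (λ d → isOddℕ d ≡ false × d ≢ f v) (off v v≢u v≢r) b)
    by-cases (yes bad-r) = Er , record
      { valid = valid′ ; bad = bad-r ; charge-≡ = charge′ ; full⇒E = full⇒E′ ; E⇒full = E⇒full′ }
      where
      Er : E r ≡ false
      Er = ¬-not λ r-full → true≢false
        (trans r-flip (cong not (trans (cong isOddℕ (E⇒full s r r-full)) (f-even r)))) (proj₁ bad-r)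
      charge′ : ∀ v → charge F′ r v ≡ charge F₀ u₀ v
      charge′ v = trans (step-charge (v ≟ u) (v ≟ r)) (charge-≡ s v)
        where
        step-charge : Dec (v ≡ u) → Dec (v ≡ r) → charge F′ r v ≡ charge F u v
        step-charge (yes refl) _ =
          trans (charge-off F′ u≢r) (trans u-flip (≡-sym (charge-at F refl)))
        step-charge (no v≢u) (yes refl) =
          trans (charge-at F′ refl) (trans (cong not r-flip)
            (trans (not-involutive _) (≡-sym (charge-off F v≢u))))
        step-charge (no v≢u) (no v≢r) =
          trans (charge-off F′ v≢r) (trans (cong isOddℕ (off v v≢u v≢r)) (≡-sym (charge-off F v≢u)))
      full⇒E′ : ∀ v → degree F′ v ≡ f v → E v ≡ true
      full⇒E′ v full with v ≟ u | v ≟ r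
      ... | yes refl | _        = true≢false u-odd (trans (cong isOddℕ full) (f-even u))
      ... | no _     | yes refl = ⊥-elim (proj₂ bad-r full)
      ... | no v≢u   | no v≢r   = full⇒E s v (trans (≡-sym (off v v≢u v≢r)) full)
      E⇒full′ : ∀ v → E v ≡ true → degree F′ v ≡ f v
      E⇒full′ v Ev with v ≟ u | v ≟ r
      ... | yes refl | _        = true≢false Ev (bad⇒¬E s)
      ... | no _     | yes refl = true≢false Ev Er
      ... | no v≢u   | no v≢r   = trans (off v v≢u v≢r) (E⇒full s v Ev)

  raise : ∀ {F : Spanning G} {v} → Valid f F → degree F v ≢ f v → ∀ {d} → d ≤ suc (degree F v) → d ≤ f v
  raise {v = v} valid-F ¬full d≤ = ≤-trans d≤ (≤∧≢⇒< (valid-F v) ¬full)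

  -- The alternative keeps the degree of `r` within `f r`. In its second case `E r ≡ false` is the
  -- gain: no edge of `F` joins the bad vertex to `E`.
  move : ∀ {F u r} (s : State F u) (ur : adj G u r ≡ true) → E r ≡ false ⊎ edge F u r ≡ true →
    E r ≡ false × State (toggle F ur) r
  move {F} {u} {r} s ur free =
    shift s (adj⇒≢ {G = G} ur) (degree-unchanged F ur)
      (raise {F} (valid s) (proj₂ (bad s)) (flip-≤ F ur (degree-flipˡ F ur)))
      (r-valid free)
      (flip-parity F ur (degree-flipˡ F ur)) (flip-parity F ur (degree-flipʳ F ur))
    where
    r-valid : E r ≡ false ⊎ edge F u r ≡ true → degree (toggle F ur) r ≤ f r
    r-valid (inj₁ ¬Er) =
      raise {F} (valid s) (λ full → true≢false (full⇒E s r full) ¬Er) (flip-≤ F ur (degree-flipʳ F ur))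
    r-valid (inj₂ e) = ≤-trans (n≤1+n _)
      (≤-trans (≤-reflexive (≡-sym (flip-removed F ur e (degree-flipʳ F ur)))) (valid s r))

  -- By `move` the edge `ut` is absent from `F`, so `u` and `r` are distinct and the first toggle
  -- adds `ut`. The second deletes `tr`, which restores the degree of `t`.
  move-through : ∀ {F u t r} (s : State F u) (ut : adj G u t ≡ true) (tr : adj G t r ≡ true) →
    E t ≡ true → edge F t r ≡ true → E r ≡ false × State (toggle (toggle F ut) tr) r
  move-through {F} {u} {t} {r} s ut tr Et tr∈F =
    shift s u≢r off u-valid r-valid u-flip r-flip
    where
    F₁ F₂ : Spanning G
    F₁ = toggle F ut
    F₂ = toggle F₁ tr
    ut∉F : edge F u t ≡ false
    ut∉F = ¬-not λ e → true≢false Et (proj₁ (move s ut (inj₂ e)))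
    u≢r : u ≢ r
    u≢r refl = true≢false tr∈F (trans (esym F t u) ut∉F)
    u≢t : u ≢ t
    u≢t = adj⇒≢ {G = G} ut
    t≢r : t ≢ r
    t≢r = adj⇒≢ {G = G} tr
    tr∈F₁ : edge F₁ t r ≡ true
    tr∈F₁ = trans (toggle-unchanged F ut t r (u≢t ∘ ≡-sym ∘ proj₁) (u≢r ∘ ≡-sym ∘ proj₂)) tr∈F
    u-degree : degree F₂ u ≡ degree F₁ u
    u-degree = degree-unchanged F₁ tr u u≢t u≢r
    r-degree : degree F₁ r ≡ degree F r
    r-degree = degree-unchanged F ut r (u≢r ∘ ≡-sym) (t≢r ∘ ≡-sym)
    t-degree : degree F₂ t ≡ degree F t
    t-degree = suc-injective (trans (≡-sym (flip-removed F₁ tr tr∈F₁ (degree-flipˡ F₁ tr)))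
                                    (flip-added F ut ut∉F (degree-flipʳ F ut)))
    off : ∀ v → v ≢ u → v ≢ r → degree F₂ v ≡ degree F v
    off v v≢u v≢r = by-cases (v ≟ t)
      where
      by-cases : Dec (v ≡ t) → degree F₂ v ≡ degree F v
      by-cases (yes refl) = t-degree
      by-cases (no v≢t)   = trans (degree-unchanged F₁ tr v v≢t v≢r) (degree-unchanged F ut v v≢u v≢t)
    u-valid : degree F₂ u ≤ f u
    u-valid = raise {F} (valid s) (proj₂ (bad s))
      (≤-trans (≤-reflexive u-degree) (flip-≤ F ut (degree-flipˡ F ut)))
    r-valid : degree F₂ r ≤ f r
    r-valid = ≤-trans (n≤1+n _) (≤-trans
      (≤-reflexive (trans (≡-sym (flip-removed F₁ tr tr∈F₁ (degree-flipʳ F₁ tr))) r-degree)) (valid s r))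
    u-flip : isOddℕ (degree F₂ u) ≡ not (isOddℕ (degree F u))
    u-flip = trans (cong isOddℕ u-degree) (flip-parity F ut (degree-flipˡ F ut))
    r-flip : isOddℕ (degree F₂ r) ≡ not (isOddℕ (degree F r))
    r-flip = trans (flip-parity F₁ tr (degree-flipʳ F₁ tr)) (cong (not ∘ isOddℕ) r-degree)

  -- Every step is a `move` to a vertex outside `E`. Only edges inside the component change, so
  -- those between it and `E` survive the walk.
  move-along : ∀ {F u w} → State F u → Conn G E u w →
    ∃ λ F′ → State F′ w × (∀ x y → edge F′ x y ≡ edge F x y ⊎ (Conn G E u x × Conn G E u y))
  move-along {F} s (here _) = F , s , λ _ _ → inj₁ refl
  move-along {F} {u} s (step {z = z} {w} c zw Ew) with move-along s c
  ... | F′ , s′ , same = toggle F′ zw , proj₂ (move s′ zw (inj₁ Ew)) , same′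
    where
    same′ : ∀ x y → edge (toggle F′ zw) x y ≡ edge F x y ⊎ (Conn G E u x × Conn G E u y)
    same′ x y with toggle-edge F′ zw x y | same x y
    ... | inj₂ (inj₁ (refl , refl)) | _      = inj₂ (c , step c zw Ew)
    ... | inj₂ (inj₂ (refl , refl)) | _      = inj₂ (step c zw Ew , c)
    ... | inj₁ _                    | inj₂ p = inj₂ p
    ... | inj₁ eq                   | inj₁ p = inj₁ (trans eq p)

  -- Walk the badness to `w`. The edge `wt` is still present, since `t` lies outside the component,
  -- and `move` along it would put `t` outside `E`.
  no-exit : ∀ {F u w t} → State F u → Conn G E u w → E t ≡ true → edge F w t ≡ true → ⊥
  no-exit {w = w} {t} s c Et wt with move-along s c
  ... | F′ , s′ , same with same w t
  ...   | inj₂ (_ , c′) = true≢false Et (conn-target c′)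
  ...   | inj₁ eq       =
    true≢false Et (proj₁ (move s′ (sub F′ w t (trans eq wt)) (inj₂ (trans eq wt))))

  -- Moving the badness to another `v` of the component shows, by invariance of the charge, that `v`
  -- has odd degree in `F`. So degree plus one is even at every vertex of the component except `u`,
  -- while the degrees alone have even sum, as no edge of `F` leaves for `E`.
  component-odd : ∀ {F u} → State F u → (p : VSet n) → (∀ w → p w ≡ true → Conn G E u w) →
    (∀ w → Conn G E u w → p w ≡ true) → isOddℕ (count p) ≡ true
  component-odd {F} {u} s p p⇒conn conn⇒p = begin
    isOddℕ (count p)
      ≡⟨ ≡-sym (Bool.xor-identityʳ _) ⟩
    isOddℕ (count p) xor false
      ≡⟨ cong (isOddℕ (count p) xor_) (≡-sym (handshake M M-sym M-diag)) ⟩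
    isOddℕ (count p) xor isOddℕ (sum λ v → sum (M v))
      ≡⟨ ≡-sym (isOdd-+ (count p) _) ⟩
    isOddℕ (count p + sum λ v → sum (M v))
      ≡⟨ cong (λ c → isOddℕ (c + sum λ v → sum (M v))) (count≡sum p) ⟩
    isOddℕ (sum (ind ∘ p) + sum λ v → sum (M v))
      ≡⟨ cong isOddℕ (trans (≡-sym (∑-distrib-+ (ind ∘ p) (λ v → sum (M v)))) (sum-cong-≗ split)) ⟩
    isOddℕ (sum g)
      ≡⟨ isOdd-sum-single g u even ⟩
    isOddℕ (g u)
      ≡⟨ cong (λ b → isOddℕ (if b then suc (degree F u) else 0)) (conn⇒p u (here (bad⇒¬E s))) ⟩
    isOddℕ (suc (degree F u))
      ≡⟨ trans (isOdd-suc (degree F u)) (cong not (proj₁ (bad s))) ⟩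
    true ∎
    where
    open ≡-Reasoning
    M : Fin n → Fin n → ℕ
    -- Only the row index is restricted to `p`; symmetry comes from `no-exit`.
    M v w = ind (p v ∧ edge F v w)
    g : Fin n → ℕ
    g v = if p v then suc (degree F v) else 0
    stays : ∀ {v w} → p v ∧ edge F v w ≡ true → p w ∧ edge F w v ≡ true
    stays {v} {w} vw with ∧-true {p v} vw
    ... | pv , e = ∧-intro
      (conn⇒p w (step (p⇒conn v pv) (sub F v w e) (¬-not λ Ew → no-exit s (p⇒conn v pv) Ew e)))
      (trans (esym F w v) e)
    M-sym : ∀ v w → M v w ≡ M w v
    M-sym v w = cong ind (≡true-ext stays stays)
    M-diag : ∀ v → M v v ≡ 0
    M-diag v with p v ∧ edge F v v in vv
    ... | false = refl
    ... | true  = ⊥-elim (adj⇒≢ {G = G} (sub F v v (proj₂ (∧-true {p v} vv))) refl)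
    split : ∀ v → ind (p v) + sum (M v) ≡ g v
    split v with p v
    ... | true  = cong suc (≡-sym (count≡sum (edge F v)))
    ... | false = sum-zero {n} _ λ _ → refl
    even : ∀ v → v ≢ u → isOddℕ (g v) ≡ false
    even v v≢u with p v in pv
    ... | false = refl
    ... | true with move-along s (p⇒conn v pv)
    ...   | F′ , s′ , _ = trans (isOdd-suc (degree F v)) (cong not (begin
      isOddℕ (degree F v)       ≡⟨ ≡-sym (charge-off F v≢u) ⟩
      charge F u v              ≡⟨ charge-≡ s v ⟩
      charge F₀ u₀ v            ≡⟨ ≡-sym (charge-≡ s′ v) ⟩
      charge F′ v v             ≡⟨ charge-at F′ refl ⟩
      not (isOddℕ (degree F′ v)) ≡⟨ cong not (proj₁ (bad s′)) ⟩
      true                      ∎))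

  -- Growing the explored set `Q`

  -- Each component inside Q can be entered from the initial state, at the vertex source; the
  -- only edge of F₀ joining that component to E is {source, gate}.
  record Entry (v : Fin n) : Set where
    field
      {current} : Spanning G
      source    : Fin n
      gate      : Fin n
      state     : State current source
      conn      : Conn G E source v
      only-gate : ∀ w t → Conn G E source w → E t ≡ true → edge F₀ w t ≡ true →
                  w ≡ source × t ≡ gate

  -- Agreement with `F₀` off `Q`, in the field `state`, ensures that an `F₀`-edge from `E` to an
  -- unexplored vertex is still there when the badness sits at any explored vertex.
  record Explored (Q : VSet n) : Set where
    field
      Q⇒¬E   : ∀ v → Q v ≡ true → E v ≡ false
      closed : ∀ v w → Q v ≡ true → adj G v w ≡ true → E w ≡ false → Q w ≡ true
      entry  : ∀ v → Q v ≡ true → Entry v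
      state  : ∀ v → Q v ≡ true → ∃ λ F → State F v ×
               (∀ x y → Q x ≡ false → Q y ≡ false → edge F x y ≡ edge F₀ x y)

    conn-closed : ∀ {v w} → Q v ≡ true → Conn G E v w → Q w ≡ true
    conn-closed Qv (here _)        = Qv
    conn-closed Qv (step c zw Ew) = closed _ _ (conn-closed Qv c) zw Ew

  open Explored

  -- A whole component of `G - E` is added at once, which preserves `closed`. Inside it the badness
  -- is walked on from `r`, with no effect on edges elsewhere.
  extend : ∀ {Q F r} → Explored Q → State F r →
    (∀ x y → Q x ≡ false → ¬ Conn G E r x → Q y ≡ false → ¬ Conn G E r y →
      edge F x y ≡ edge F₀ x y) →
    ∀ t → (∀ w t′ → Conn G E r w → E t′ ≡ true → edge F₀ w t′ ≡ true → w ≡ r × t′ ≡ t) →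
    Explored (λ x → Q x ∨ reach G E r x)
  extend {Q} {F} {r} ex s same t only = record
    { Q⇒¬E = Q⇒¬E′ ; closed = closed′ ; entry = entry′ ; state = state′ }
    where
    Q′ : VSet n
    Q′ x = Q x ∨ reach G E r x
    outside : ∀ x → Q′ x ≡ false → Q x ≡ false × ¬ Conn G E r x
    outside x Q′x =
      (¬-not λ Qx → true≢false (∨-introˡ Qx) Q′x) ,
      (λ c → true≢false (∨-introʳ (Q x) (conn⇒reach G E c)) Q′x)
    Q⇒¬E′ : ∀ v → Q′ v ≡ true → E v ≡ false
    Q⇒¬E′ v Q′v with ∨-true {Q v} Q′v
    ... | inj₁ Qv = Q⇒¬E ex v Qv
    ... | inj₂ rv = conn-target (reach⇒conn G E rv)
    closed′ : ∀ v w → Q′ v ≡ true → adj G v w ≡ true → E w ≡ false → Q′ w ≡ true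
    closed′ v w Q′v vw Ew with ∨-true {Q v} Q′v
    ... | inj₁ Qv = ∨-introˡ (closed ex v w Qv vw Ew)
    ... | inj₂ rv = ∨-introʳ (Q w) (conn⇒reach G E (step (reach⇒conn G E rv) vw Ew))
    entry′ : ∀ v → Q′ v ≡ true → Entry v
    entry′ v Q′v with ∨-true {Q v} Q′v
    ... | inj₁ Qv = entry ex v Qv
    ... | inj₂ rv = record { source = r ; gate = t ; state = s ; conn = reach⇒conn G E rv ; only-gate = only }
    state′ : ∀ v → Q′ v ≡ true → ∃ λ F → State F v ×
      (∀ x y → Q′ x ≡ false → Q′ y ≡ false → edge F x y ≡ edge F₀ x y)
    state′ v Q′v with ∨-true {Q v} Q′v
    ... | inj₁ Qv =
      let (F′ , s′ , same′) = state ex v Qv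
      in F′ , s′ , λ x y Q′x Q′y → same′ x y (proj₁ (outside x Q′x)) (proj₁ (outside y Q′y))
    ... | inj₂ rv with move-along s (reach⇒conn G E rv)
    ...   | F′ , s′ , same′ = F′ , s′ , same″
      where
      same″ : ∀ x y → Q′ x ≡ false → Q′ y ≡ false → edge F′ x y ≡ edge F₀ x y
      same″ x y Q′x Q′y with same′ x y
      ... | inj₂ (c , _) = ⊥-elim (proj₂ (outside x Q′x) c)
      ... | inj₁ eq = let (Qx , rx) = outside x Q′x ; (Qy , ry) = outside y Q′y in
        trans eq (same x y Qx rx Qy ry)

  Saturated : VSet n → Set
  Saturated Q = ∀ v t r → Q v ≡ true → adj G v t ≡ true → E t ≡ true → edge F₀ t r ≡ true → Q r ≡ true

  -- Both `t` and `r` lie outside `Q`, so `tr` belongs to the subgraph in which `v` is bad, and the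
  -- badness crosses `t` to reach `r`.
  grow-through : ∀ {Q v t r} → Explored Q → Q v ≡ true → adj G v t ≡ true → E t ≡ true →
    edge F₀ t r ≡ true → Q r ≡ false →
    E r ≡ false × Explored (λ x → Q x ∨ reach G E r x)
  grow-through {Q} {v} {t} {r} ex Qv vt Et tr∈F₀ Qr with state ex v Qv
  ... | F , s , same = proj₁ moved , extend ex s₂ same₂ t only
    where
    Qt : Q t ≡ false
    Qt = ¬-not λ Qt → true≢false Et (Q⇒¬E ex t Qt)
    tr∈F : edge F t r ≡ true
    tr∈F = trans (same t r Qt Qr) tr∈F₀
    F₁ F₂ : Spanning G
    F₁ = toggle F vt
    F₂ = toggle F₁ (sub F t r tr∈F)
    moved : E r ≡ false × State F₂ r
    moved = move-through s vt (sub F t r tr∈F) Et tr∈F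
    s₂ : State F₂ r
    s₂ = proj₂ moved
    disjoint : ∀ {w} → Conn G E r w → Q w ≡ false
    disjoint c = ¬-not λ Qw → true≢false (conn-closed ex Qw (conn-sym c)) Qr
    same₂ : ∀ x y → Q x ≡ false → ¬ Conn G E r x → Q y ≡ false → ¬ Conn G E r y →
      edge F₂ x y ≡ edge F₀ x y
    same₂ x y Qx rx Qy ry = trans
      (toggle-unchanged F₁ (sub F t r tr∈F) x y
        (λ { (_ , refl) → ry (here (proj₁ moved)) }) (λ { (refl , _) → rx (here (proj₁ moved)) }))
      (trans (toggle-unchanged F vt x y (λ { (refl , _) → true≢false Qv Qx }) (λ { (_ , refl) → true≢false Qv Qy }))
        (same x y Qx Qy))
    -- After the crossing, `no-exit` excludes all edges of `F₂` between the component of `r` and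
    -- `E`. On such pairs `F₂` and `F₀` differ only in the deleted edge `tr`.
    only : ∀ w t′ → Conn G E r w → E t′ ≡ true → edge F₀ w t′ ≡ true → w ≡ r × t′ ≡ t
    only w t′ c Et′ wt′ with toggle-edge F₁ (sub F t r tr∈F) w t′ | toggle-edge F vt w t′
    ... | inj₂ (inj₁ (refl , _)) | _ = true≢false Et (conn-target c)
    ... | inj₂ (inj₂ p)          | _ = p
    ... | inj₁ _ | inj₂ (inj₁ (refl , _)) = true≢false Qv (disjoint c)
    ... | inj₁ _ | inj₂ (inj₂ (refl , _)) = true≢false Et (conn-target c)
    ... | inj₁ eq₂ | inj₁ eq₁ = ⊥-elim (no-exit s₂ c Et′ (trans eq₂ (trans eq₁
      (trans (same w t′ (disjoint c) (¬-not λ Qt′ → true≢false Et′ (Q⇒¬E ex t′ Qt′))) wt′))))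

  saturate : ∀ k Q → Explored Q → Q u₀ ≡ true → count (not ∘ Q) < k →
    ∃ λ Q′ → Explored Q′ × Q′ u₀ ≡ true × Saturated Q′
  saturate (suc k) Q ex Qu₀ (s≤s ≤k)
    with any? (λ v → any? (λ t → any? (λ r → (Q v Bool.≟ true) ×-dec (adj G v t Bool.≟ true) ×-dec
           (E t Bool.≟ true) ×-dec (edge F₀ t r Bool.≟ true) ×-dec (Q r Bool.≟ false))))
  ... | no ¬ext = Q , ex , Qu₀ , λ v t r Qv vt Et tr →
    ¬-not λ Qr → ¬ext (v , t , r , Qv , vt , Et , tr , Qr)
  ... | yes (v , t , r , Qv , vt , Et , tr , Qr) =
    saturate k Q′ (proj₂ grown) (∨-introˡ Qu₀)
      (<-≤-trans (count-mono-< shrink r (cong not Q′r) (cong not Qr)) ≤k)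
    where
    Q′ : VSet n
    Q′ x = Q x ∨ reach G E r x
    grown : E r ≡ false × Explored Q′
    grown = grow-through ex Qv vt Et tr Qr
    Q′r : Q′ r ≡ true
    Q′r = ∨-introʳ (Q r) (conn⇒reach G E (here (proj₁ grown)))
    shrink : ∀ x → not (Q′ x) ≡ true → not (Q x) ≡ true
    shrink x nQ′x with Q x
    ... | false = refl
    ... | true  = nQ′x

  start : ∃ λ Q → Explored Q × Q u₀ ≡ true × Saturated Q
  start = saturate _ _
    -- The gate `u₀` is a dummy: by `no-exit` the first component has no edge of `F₀` to `E`.
    (extend nothing initial (λ _ _ _ _ _ _ → refl) u₀ (λ w t c Et wt → ⊥-elim (no-exit initial c Et wt)))
    (conn⇒reach G E (here (bad⇒¬E initial))) (n<1+n _)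
    where
    nothing : Explored (λ _ → false)
    nothing = record { Q⇒¬E = λ _ () ; closed = λ _ _ () ; entry = λ _ () ; state = λ _ () }

  -- The barrier `S` and the double counting

  module Barrier {Q : VSet n} (ex : Explored Q) (Qu₀ : Q u₀ ≡ true) (sat : Saturated Q) where

    next-to-Q? : ∀ t → Dec (∃ λ v → Q v ≡ true × adj G v t ≡ true)
    next-to-Q? t = any? λ v → (Q v Bool.≟ true) ×-dec (adj G v t Bool.≟ true)

    S : VSet n
    S t = E t ∧ ⌊ next-to-Q? t ⌋

    S⇒E : ∀ {t} → S t ≡ true → E t ≡ true
    S⇒E {t} St = proj₁ (∧-true {E t} St)

    ¬E⇒¬S : ∀ t → E t ≡ false → S t ≡ false
    ¬E⇒¬S t Et = ¬-not λ St → true≢false (S⇒E St) Et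

    Q⇒¬S : ∀ {v} → Q v ≡ true → S v ≡ false
    Q⇒¬S {v} Qv = ¬E⇒¬S v (Q⇒¬E ex v Qv)

    S-edge⇒Q : ∀ {t r} → S t ≡ true → edge F₀ t r ≡ true → Q r ≡ true
    S-edge⇒Q {t} {r} St tr with ∧-true {E t} St
    ... | Et , near with isYes⁻ (next-to-Q? t) near
    ...   | v , Qv , vt = sat v t r Qv vt Et tr

    -- A walk that starts in `Q` and avoids `S` never enters `E`, because a vertex of `E` next to
    -- `Q` is in `S`; then `closed` keeps it in `Q`. So the components of `G - S` that meet `Q` are
    -- components of `G - E`.
    connS⇒Q×connE : ∀ {v w} → Q v ≡ true → Conn G S v w → Q w ≡ true × Conn G E v w
    connS⇒Q×connE {v} Qv (here _) = Qv , here (Q⇒¬E ex v Qv)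
    connS⇒Q×connE Qv (step {z = z} {y} c zy Sy) with connS⇒Q×connE Qv c
    ... | Qz , c′ = closed ex z y Qz zy Ey , step c′ zy Ey
      where
      Ey : E y ≡ false
      Ey = ¬-not λ Ey → true≢false (∧-intro Ey (isYes⁺ (next-to-Q? y) (z , Qz , zy))) Sy

    class-odd : ∀ {v} → Q v ≡ true → isOddℕ (count (reach G S v)) ≡ true
    class-odd {v} Qv = component-odd (Entry.state en) (reach G S v)
      (λ w vw → conn-trans (Entry.conn en) (proj₂ (connS⇒Q×connE Qv (reach⇒conn G S vw))))
      (λ w c → conn⇒reach G S (conn-antitone ¬E⇒¬S (conn-trans (conn-sym (Entry.conn en)) c)))
      where
      en : Entry v
      en = entry ex v Qv

    toS : Fin n → ℕ
    toS r = sum λ t → ind (S t ∧ edge F₀ t r)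

    toS-zero : ∀ {r} → (∀ t → S t ≡ true → edge F₀ t r ≡ true → ⊥) → toS r ≡ 0
    toS-zero none = sum-zero _ λ t → cong ind (¬-not λ p → let (St , tr) = ∧-true {S t} p in none t St tr)

    -- Vertices of `S` are full in `F₀`, so `fSum f S` counts the edges of `F₀` at `S` by their ends
    -- in `S`; exchanging the sums counts them by the other end.
    fSum≡toS : fSum f S ≡ sum toS
    fSum≡toS = trans (fSum≡sum f S) (trans (sum-cong-≗ row) (∑-comm λ t r → ind (S t ∧ edge F₀ t r)))
      where
      row : ∀ t → (if S t then f t else 0) ≡ sum λ r → ind (S t ∧ edge F₀ t r)
      row t with S t in St
      ... | true  = trans (≡-sym (E⇒full initial t (S⇒E St))) (count≡sum (edge F₀ t))
      ... | false = ≡-sym (sum-zero {n} _ λ _ → refl)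

    -- For a representative `v`, `sum (share v)` is the number of `F₀`-edges between `S` and the
    -- component of `v`; for any other `v` it is zero.
    share : Fin n → Fin n → ℕ
    share v r = if isRep G S v ∧ reach G S v r then toS r else 0

    -- Saturation sends every edge at `S` into `Q`, hence into a component of `G - S`, which has a
    -- representative.
    toS≤shares : ∀ r → toS r ≤ sum λ v → share v r
    toS≤shares r with Q r in Qr
    ... | false =
      ≤-trans (≤-reflexive (toS-zero λ t St tr → true≢false (S-edge⇒Q St tr) Qr)) z≤n
    ... | true with representative G S (Q⇒¬S Qr)
    ...   | v , rep , vr = subst (_≤ sum (λ v → share v r))
      (cong (λ b → if b then toS r else 0) (∧-intro rep vr)) (term≤sum (λ v → share v r) v)

    share-zero : ∀ {v r} → (Conn G S v r → toS r ≡ 0) → share v r ≡ 0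
    share-zero {v} {r} zeros with isRep G S v ∧ reach G S v r in b
    ... | false = refl
    ... | true  = zeros (reach⇒conn G S (proj₂ (∧-true {isRep G S v} b)))

    share≤toS : ∀ v r → share v r ≤ toS r
    share≤toS v r with isRep G S v ∧ reach G S v r
    ... | true  = ≤-refl
    ... | false = z≤n

    -- By `only-gate` the single possible edge is the one through which the component was entered.
    shares≤1 : ∀ {v} → Q v ≡ true → sum (share v) ≤ 1
    shares≤1 {v} Qv = begin
      sum (share v)     ≡⟨ sum-single (share v) source off-source ⟩
      share v source    ≤⟨ share≤toS v source ⟩
      toS source        ≡⟨ sum-single _ gate off-gate ⟩
      ind (S gate ∧ edge F₀ gate source) ≤⟨ ind-mono {S gate ∧ edge F₀ gate source} {true} (λ _ → refl) ⟩
      1                 ∎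
      where
      open ≤-Reasoning
      open Entry (entry ex v Qv)
      toE : ∀ {t r} → S t ≡ true → edge F₀ t r ≡ true → Conn G E source r → r ≡ source × t ≡ gate
      toE {t} {r} St tr c = only-gate r t c (S⇒E St) (trans (esym F₀ r t) tr)
      off-source : ∀ r → r ≢ source → share v r ≡ 0
      off-source r r≢ = share-zero λ c → toS-zero λ t St tr →
        r≢ (proj₁ (toE St tr (conn-trans conn (proj₂ (connS⇒Q×connE Qv c)))))
      off-gate : ∀ t → t ≢ gate → ind (S t ∧ edge F₀ t source) ≡ 0
      off-gate t t≢ = cong ind (¬-not λ p → let (St , tr) = ∧-true {S t} p in
        t≢ (proj₂ (toE St tr (here (conn-source conn)))))

    oddRep : VSet n
    oddRep v = isRep G S v ∧ isOddℕ (count (reach G S v))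

    shares-zero : ∀ {v} → (∀ r → Conn G S v r → toS r ≡ 0) → sum (share v) ≡ 0
    shares-zero {v} zeros = sum-zero (share v) λ r → share-zero (zeros r)

    -- A representative in `Q` has an odd component with at most one edge to `S`. One outside `Q`
    -- has none, since edges at `S` end in `Q` and `Q` is a union of components of `G - S`.
    shares≤oddRep : ∀ v → sum (share v) ≤ ind (oddRep v)
    shares≤oddRep v with Q v Bool.≟ true | isRep G S v Bool.≟ true
    ... | yes Qv | yes rep = subst (sum (share v) ≤_) (cong ind (≡-sym (∧-intro rep (class-odd Qv)))) (shares≤1 Qv)
    ... | _      | no ¬rep = subst (_≤ ind (oddRep v)) (≡-sym (sum-zero (share v) λ r →
      cong (λ b → if b ∧ reach G S v r then toS r else 0) (¬-not ¬rep))) z≤n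
    ... | no ¬Qv | yes _   = subst (_≤ ind (oddRep v)) (≡-sym (shares-zero λ r c → toS-zero λ t St tr →
      ¬Qv (proj₁ (connS⇒Q×connE (S-edge⇒Q St tr) (conn-sym c))))) z≤n

    -- The component of u₀ is odd but has no edge of F₀ to S, which makes the inequality strict.
    u₀-strict : ∃ λ v → sum (share v) < ind (oddRep v)
    u₀-strict with representative G S (Q⇒¬S Qu₀)
    ... | v , rep , vu₀ = v , (begin-strict
      sum (share v)    ≡⟨ shares-zero (λ r c → toS-zero λ t St tr → no-exit initial
                            (proj₂ (connS⇒Q×connE Qu₀ (conn-trans (conn-sym v~u₀) c)))
                            (S⇒E St) (trans (esym F₀ r t) tr)) ⟩
      0                <⟨ s≤s z≤n ⟩
      1                ≡⟨ cong ind (≡-sym (∧-intro rep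
                            (class-odd (proj₁ (connS⇒Q×connE Qu₀ (conn-sym v~u₀)))))) ⟩
      ind (oddRep v)   ∎)
      where
      open ≤-Reasoning
      v~u₀ : Conn G S v u₀
      v~u₀ = reach⇒conn G S vu₀

    violated : fSum f S < oddComponents G S
    violated = begin-strict
      fSum f S                         ≡⟨ fSum≡toS ⟩
      sum toS                          ≤⟨ sum-mono-≤ toS≤shares ⟩
      sum (λ r → sum λ v → share v r)  ≡⟨ ∑-comm (λ r v → share v r) ⟩
      sum (λ v → sum (share v))        <⟨ sum-mono-< shares≤oddRep (proj₁ u₀-strict) (proj₂ u₀-strict) ⟩
      sum (ind ∘ oddRep)               ≡⟨ ≡-sym (count≡sum oddRep) ⟩
      oddComponents G S                ∎
      where open ≤-Reasoning

  barrier : ∃ λ S → fSum f S < oddComponents G S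
  barrier with start
  ... | Q , ex , Qu₀ , sat = Barrier.S ex Qu₀ sat , Barrier.violated ex Qu₀ sat

-- Descent on the number of bad vertices

no-bad⇒IsHFactor : ∀ {n} {G : Graph n} {f : Fin n → ℕ} (F : Spanning G) → Valid f F →
  (∀ v → ¬ Bad f F v) → IsHFactor (λ v → Hf (f v)) F
no-bad⇒IsHFactor {f = f} F valid ¬bad v with degree F v ℕ.≟ f v
... | yes full = inj₂ full
... | no ¬full = inj₁ ((λ 2∣d → ¬bad v (2∣⇒even _ 2∣d , ¬full)) , ≤∧≢⇒< (valid v) ¬full)

empty : ∀ {n} {G : Graph n} → Spanning G
empty = record { edge = λ _ _ → false ; esym = λ _ _ → refl ; sub = λ _ _ () }

theorem5 : (n : ℕ) → (G : Graph n) → 2 ∣ n → (f : Fin n → ℕ) →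
    (∀ v → 2 ∣ f v) → (∀ v → 4 ≤ f v) →
    (∀ (S : VSet n) → oddComponents G S ≤ fSum f S) →
    Σ (Spanning G) (λ F → IsHFactor (λ v → Hf (f v)) F)
theorem5 n G _ f f-even _ o≤f =
  decidable-stable (HFactor? G f) λ none → descend none _ empty empty-valid (n<1+n _)
  where
  empty-valid : Valid {G = G} f empty
  empty-valid v = ≤-trans (≤-reflexive
    (trans (count≡sum {n} (λ _ → false)) (sum-zero {n} (λ _ → 0) λ _ → refl))) z≤n
  descend : ¬ Σ (Spanning G) (IsHFactor (λ v → Hf (f v))) →
    ∀ k (F : Spanning G) → Valid f F → badCount f F < k → ⊥
  descend none (suc k) F valid (s≤s ≤k) with any? (bad? f F)
  ... | no ¬bad = none (F , no-bad⇒IsHFactor F valid λ v b → ¬bad (v , b))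
  ... | yes (u , bad-u) =
    -- The induction hypothesis refutes every valid subgraph with fewer bad vertices, which is the
    -- minimality required; the barrier then contradicts `o≤f`.
    let (S , f<o) = Improve.barrier (λ v → 2∣⇒even (f v) (f-even v)) F valid bad-u
                      (λ F′ valid′ fewer → descend none k F′ valid′ (<-≤-trans fewer ≤k))
    in <-irrefl refl (<-≤-trans f<o (o≤f S))
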